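{- Let $k\geq 1$ be an integer and let $T$ be a tournament with $4k+2$ vertices. If the simplicity index of $T$ satisfies $s(T)=2k$, then $T$ is obtained from a doubly regular tournament by removing one vertex.
   Context: A tournament $T=(V,A)$ consists of a finite vertex set $V$ and a set $A$ of ordered pairs of distinct vertices (arcs) such that for all $x\neq y\in V$, $(x,y)\in A$ if and only if $(y,x)\notin A$. One writes $x\rightarrow y$ ($x$ dominates $y$) when $(x,y)\in A$. A tournament is doubly regular if there is an integer $m\geq 1$ such that for every unordered pair $\{x,y\}$ of distinct vertices there are exactly $m$ vertices $z$ with $x\rightarrow z$ and $y\rightarrow z$. Removing a vertex means taking the subtournament induced by the remaining vertices. A module of $T$ is a subset $M\subseteq V$ such that for every $x\in V\setminus M$, either $m\rightarrow x$ for all $m\in M$, or $x\rightarrow m$ for all $m\in M$. The trivial modules are $\emptyset$, the singletons and $V$. A tournament with $n$ vertices is simple if $n\geq 3$ and all its modules are trivial. For a tournament $T$ with at least $3$ vertices, the simplicity index $s(T)$ is the minimum number of arcs of $T$ whose reversal yields a non-simple tournament (so $s(T)=0$ if $T$ is not simple). -}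

module Defs where

open import Algebra.Properties.CommutativeMonoid.Sum using (sum)
open import Data.Bool.Base using (Bool; true; false; not; _∧_; _∨_)
open import Data.Fin.Base using (Fin; punchIn)
open import Data.Fin.Permutation using (Permutation′; _⟨$⟩ʳ_)
open import Data.Fin.Properties using (punchIn-injective)
open import Data.Fin.Subset using (Subset; ⊥; ⊤; ⁅_⁆; _∈_; _∉_; ∣_∣)
open import Data.Nat.Base using (ℕ; suc; _≤_)
open import Data.Nat.Properties using (+-0-commutativeMonoid)
open import Data.Product.Base using (Σ-syntax; ∃-syntax; _×_)
open import Data.Sum.Base using (_⊎_)
open import Data.Vec.Base using (tabulate)
open import Function.Base using (_∘_)
open import Relation.Binary.PropositionalEquality
  using (_≡_; _≢_; refl; sym)
open import Relation.Nullary using (¬_)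

-- A set of ordered pairs of vertices, given by its characteristic function.
PairSet : ℕ → Set
PairSet n = Fin n → Fin n → Bool

card : ∀ {n} → PairSet n → ℕ
card E = sum +-0-commutativeMonoid (λ x → ∣ tabulate (E x) ∣)

-- Tournaments on n vertices; the vertex set is taken to be Fin n.
record Tournament (n : ℕ) : Set where
  field
    arc    : PairSet n
    irrefl : ∀ x → arc x x ≡ false
    -- (x , y) is an arc if and only if (y , x) is not.
    orient : ∀ x y → x ≢ y → arc x y ≡ not (arc y x)

  infix 4 _⟶_
  _⟶_ : Fin n → Fin n → Set
  x ⟶ y = arc x y ≡ true

open Tournament public using (arc)

Trivial : ∀ {n} → Subset n → Set
Trivial M = M ≡ ⊥ ⊎ (∃[ x ] M ≡ ⁅ x ⁆) ⊎ M ≡ ⊤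

module _ {n : ℕ} (𝕋 : Tournament n) where
  open Tournament 𝕋 using (_⟶_)

  commonOut : Fin n → Fin n → Subset n
  commonOut x y = tabulate (λ z → arc 𝕋 x z ∧ arc 𝕋 y z)

  DoublyRegular : Set
  DoublyRegular =
    ∃[ m ] 1 ≤ m × (∀ x y → x ≢ y → ∣ commonOut x y ∣ ≡ m)

  IsModule : Subset n → Set
  IsModule M = ∀ x → x ∉ M →
    (∀ m → m ∈ M → m ⟶ x) ⊎ (∀ m → m ∈ M → x ⟶ m)

  Simple : Set
  Simple = 3 ≤ n × (∀ M → IsModule M → Trivial M)

  ArcsOf : PairSet n → Set
  ArcsOf B = ∀ x y → B x y ≡ true → x ⟶ y

-- Reversing a set B of arcs replaces the arc set A by (A ∖ B) ∪ B⁻¹.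
reverse : ∀ {n} (𝕋 : Tournament n) (B : PairSet n) → ArcsOf 𝕋 B → Tournament n
reverse {n} 𝕋 B B⊆A = record
  { arc    = arc′
  ; irrefl = λ x → loop (arc 𝕋 x x) (B x x) (irrefl x) (B⊆A x x)
  ; orient = λ x y x≢y →
      flip (arc 𝕋 x y) (arc 𝕋 y x) (B x y) (B y x)
        (orient x y x≢y) (B⊆A x y) (B⊆A y x)
  }
  where
  open Tournament 𝕋 using (irrefl; orient)

  arc′ : PairSet n
  arc′ x y = (arc 𝕋 x y ∧ not (B x y)) ∨ B y x

  loop : ∀ a b → a ≡ false → (b ≡ true → a ≡ true) → (a ∧ not b) ∨ b ≡ false
  loop false false _ _ = refl
  loop false true  _ h = sym (h refl)

  flip : ∀ a a′ b b′ → a ≡ not a′ →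
         (b ≡ true → a ≡ true) → (b′ ≡ true → a′ ≡ true) →
         (a ∧ not b) ∨ b′ ≡ not ((a′ ∧ not b′) ∨ b)
  flip true  false true  false _ _ _  = refl
  flip true  false false false _ _ _  = refl
  flip true  false true  true  _ _ h′ with () ← h′ refl
  flip true  false false true  _ _ h′ with () ← h′ refl
  flip false true  false true  _ _ _  = refl
  flip false true  false false _ _ _  = refl
  flip false true  true  _     _ h _  with () ← h refl

-- s is the minimum number of arcs of 𝕋 whose reversal yields a non-simple
-- tournament.  The minimum exists, and is then unique, whenever n ≥ 3.
SimplicityIndex : ∀ {n} → Tournament n → ℕ → Set
SimplicityIndex {n} 𝕋 s =
    (Σ[ B ∈ PairSet n ] Σ[ B⊆A ∈ ArcsOf 𝕋 B ]
       card B ≡ s × ¬ Simple (reverse 𝕋 B B⊆A))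
  × (∀ B (B⊆A : ArcsOf 𝕋 B) → ¬ Simple (reverse 𝕋 B B⊆A) → s ≤ card B)

-- The subtournament induced by the vertices other than v, relabelled by
-- punchIn v, the increasing bijection from Fin n onto Fin (suc n) ∖ {v}.
remove : ∀ {n} → Fin (suc n) → Tournament (suc n) → Tournament n
remove v 𝔻 = record
  { arc    = λ x y → arc 𝔻 (punchIn v x) (punchIn v y)
  ; irrefl = λ x → irrefl (punchIn v x)
  ; orient = λ x y x≢y →
      orient (punchIn v x) (punchIn v y) (x≢y ∘ punchIn-injective v x y)
  }
  where open Tournament 𝔻 using (irrefl; orient)

infix 4 _≅_
_≅_ : ∀ {n} → Tournament n → Tournament n → Set
_≅_ {n} 𝕋 𝕌 = Σ[ π ∈ Permutation′ n ]
  (∀ x y → arc 𝕋 x y ≡ arc 𝕌 (π ⟨$⟩ʳ x) (π ⟨$⟩ʳ y))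

-- Vertex names carry no information, so 𝕋 is only required to be isomorphic
-- to the tournament left after the removal.
ObtainedByRemovingVertexFromDoublyRegular : ∀ {n} → Tournament n → Set
ObtainedByRemovingVertexFromDoublyRegular {n} 𝕋 =
  Σ[ 𝔻 ∈ Tournament (suc n) ] DoublyRegular 𝔻 × (∃[ v ] 𝕋 ≅ remove v 𝔻)

{-# OPTIONS --safe #-}
-- Redirecting all arcs at x makes V ∖ {x} a module, so all in- and outdegrees of
-- 𝕋 are at least 2k, i.e. each outdegree is 2k or 2k+1.  Turning x into a twin of y
-- makes {x , y} a module, so at least 2k vertices separate x and y.  Add a new
-- vertex v dominated exactly by the vertices of outdegree 2k: every vertex of the
-- result 𝔻 has in- and outdegree 2k+1, and the separation bound says that two
-- old vertices have at most k common out-neighbours.  Double counting the common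
-- out-neighbours of all pairs in 𝔻 shows that these bounds are all attained, and
-- the row sum at an old vertex x then forces the value k for the pair {x , v} too.
module Submission where

open import Defs
open import Data.Bool.Base using (Bool; true; false; not; _∧_; _∨_)
open import Data.Bool.Properties using (∧-conicalˡ; not-involutive)
open import Data.Fin.Base using (Fin; zero; suc; punchIn; punchOut)
open import Data.Fin.Permutation using () renaming (id to idₚ)
open import Data.Fin.Properties
  using (_≟_; punchInᵢ≢i; punchIn-injective; punchIn-punchOut)
open import Data.Fin.Subset using (Subset; ⁅_⁆; _∈_; _∉_; ∣_∣; ∁; _∪_)
open import Data.Fin.Subset.Properties
  using (∉⊥; ∈⊤; x∈⁅x⁆; x∈⁅y⁆⇒x≡y; x∈∁p⇒x∉p; x∉∁p⇒x∈p; x∉p⇒x∈∁p;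
         x∈p⇒x∉∁p; x∈p∪q⁺; x∈p∪q⁻)
open import Data.Nat.Base using (ℕ; zero; suc; _≤_; _+_; _*_; z≤n; s≤s)
import Data.Nat.Properties as ℕ
open import Algebra.Properties.Semiring.Sum ℕ.+-*-semiring
  using (sum; sum-cong-≗; ∑-distrib-+; ∑-comm; *-distribˡ-sum; *-distribʳ-sum)
open import Data.Nat.Tactic.RingSolver using (solve-∀)
open import Data.Product.Base using (∃-syntax; _×_; _,_)
open import Data.Sum.Base using (_⊎_; inj₁; inj₂; [_,_]′)
open import Data.Vec.Base using (tabulate)
open import Function.Base using (_∘_; const)
open import Relation.Binary.PropositionalEquality
  using (_≡_; _≢_; _≗_; refl; sym; trans; cong; cong₂; subst; module ≡-Reasoning)
open import Relation.Nullary using (¬_; yes; no; does; contradiction)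
open import Relation.Nullary.Decidable using (dec-true; dec-false)

-- Finite sums, indicator values and nontrivial subsets.

private
  variable
    n : ℕ

⟦_⟧ : Bool → ℕ
⟦ true  ⟧ = 1
⟦ false ⟧ = 0

δ : Fin n → Fin n → ℕ
δ x y = ⟦ does (x ≟ y) ⟧

sum-const : ∀ n c → sum {n} (const c) ≡ n * c
sum-const zero    c = refl
sum-const (suc n) c = cong (c +_) (sum-const n c)

sum-δ : (x : Fin n) (f : Fin n → ℕ) → sum (λ a → δ a x * f a) ≡ f x
sum-δ {suc n} zero f = begin
  1 * f zero + sum {n} (const 0)  ≡⟨ cong₂ _+_ (ℕ.*-identityˡ (f zero)) (sum-const n 0) ⟩
  f zero + n * 0                  ≡⟨ cong (f zero +_) (ℕ.*-zeroʳ n) ⟩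
  f zero + 0                      ≡⟨ ℕ.+-identityʳ (f zero) ⟩
  f zero                          ∎
  where open ≡-Reasoning
sum-δ (suc x) f = sum-δ x (f ∘ suc)

sum-mono-≤ : {f g : Fin n → ℕ} → (∀ i → f i ≤ g i) → sum f ≤ sum g
sum-mono-≤ {zero}  f≤g = z≤n
sum-mono-≤ {suc n} f≤g = ℕ.+-mono-≤ (f≤g zero) (sum-mono-≤ (f≤g ∘ suc))

-- Slack at a single index would make the total of `f` strictly smaller than that of `g`. Head and
-- tail are compared by cancelling the bound known for the other.
sum-tight : {f g : Fin n → ℕ} → (∀ i → f i ≤ g i) → sum g ≤ sum f → f ≗ g
sum-tight {suc n} {f} {g} f≤g Σg≤Σf zero = ℕ.≤-antisym (f≤g zero)
  (ℕ.+-cancelʳ-≤ (sum (g ∘ suc)) (g zero) (f zero)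
    (ℕ.≤-trans Σg≤Σf (ℕ.+-monoʳ-≤ (f zero) (sum-mono-≤ (f≤g ∘ suc)))))
sum-tight {suc n} {f} {g} f≤g Σg≤Σf (suc i) = sum-tight (f≤g ∘ suc)
  (ℕ.+-cancelˡ-≤ (f zero) (sum (g ∘ suc)) (sum (f ∘ suc))
    (ℕ.≤-trans (ℕ.+-monoˡ-≤ (sum (g ∘ suc)) (f≤g zero)) Σg≤Σf)) i

∣tabulate∣ : (f : Fin n → Bool) → ∣ tabulate f ∣ ≡ sum (⟦_⟧ ∘ f)
∣tabulate∣ {zero}  f = refl
∣tabulate∣ {suc n} f with f zero
... | true  = cong suc (∣tabulate∣ (f ∘ suc))
... | false = ∣tabulate∣ (f ∘ suc)

⟦∧⟧ : ∀ a b → ⟦ a ∧ b ⟧ ≡ ⟦ a ⟧ * ⟦ b ⟧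
⟦∧⟧ true  b = sym (ℕ.+-identityʳ ⟦ b ⟧)
⟦∧⟧ false b = refl

⟦∨⟧-≤ : ∀ a b → ⟦ a ∨ b ⟧ ≤ ⟦ a ⟧ + ⟦ b ⟧
⟦∨⟧-≤ true  b = s≤s z≤n
⟦∨⟧-≤ false b = ℕ.≤-refl

∃-distinct : 3 ≤ n → (x y : Fin n) → ∃[ z ] z ≢ x × z ≢ y
∃-distinct (s≤s (s≤s (s≤s _))) x y with x ≟ y
... | yes refl = z , punchInᵢ≢i x zero , punchInᵢ≢i x zero
  where z = punchIn x zero
... | no x≢y   = punchIn x z , punchInᵢ≢i x z , λ e →
  punchInᵢ≢i (punchOut x≢y) zero
    (punchIn-injective x _ _ (trans e (sym (punchIn-punchOut x≢y))))
  where z = punchIn (punchOut x≢y) zero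

nontrivial : ∀ {M : Subset n} {a b c} → a ∈ M → b ∈ M → a ≢ b → c ∉ M → ¬ Trivial M
nontrivial a∈M b∈M a≢b c∉M (inj₁ refl) = ∉⊥ a∈M
nontrivial a∈M b∈M a≢b c∉M (inj₂ (inj₁ (x , refl))) =
  a≢b (trans (x∈⁅y⁆⇒x≡y x a∈M) (sym (x∈⁅y⁆⇒x≡y x b∈M)))
nontrivial a∈M b∈M a≢b c∉M (inj₂ (inj₂ refl)) = c∉M ∈⊤

-- Degrees and common out-neighbour counts.

module Degrees (𝕋 : Tournament n) where
  open Tournament 𝕋 using (irrefl; orient)

  A : Fin n → Fin n → ℕ
  A x y = ⟦ arc 𝕋 x y ⟧

  outdeg indeg : Fin n → ℕ
  outdeg x = sum (A x)
  indeg  x = sum (λ y → A y x)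

  codeg : Fin n → Fin n → ℕ
  codeg x y = sum (λ z → A x z * A y z)

  -- The term `δ y x` covers the diagonal, so the identity can be summed over all vertices: plainly
  -- in `degree-sum`, weighted by a row of `A` in `gain-eq`.
  arc-total : ∀ x y → A y x + A x y + δ y x ≡ 1
  arc-total x y with y ≟ x
  ... | yes refl rewrite irrefl x = refl
  ... | no y≢x rewrite orient y x y≢x with arc 𝕋 x y
  ...   | true  = refl
  ...   | false = refl

  degree-sum : ∀ x → indeg x + outdeg x + 1 ≡ n
  degree-sum x = begin
    indeg x + outdeg x + 1
      ≡⟨ cong (indeg x + outdeg x +_) (sum-δ x (const 1)) ⟨
    indeg x + outdeg x + sum (λ y → δ y x * 1)
      ≡⟨ cong (_+ sum (λ y → δ y x * 1)) (∑-distrib-+ (λ y → A y x) (A x)) ⟨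
    sum (λ y → A y x + A x y) + sum (λ y → δ y x * 1)
      ≡⟨ ∑-distrib-+ (λ y → A y x + A x y) (λ y → δ y x * 1) ⟨
    sum (λ y → A y x + A x y + δ y x * 1)
      ≡⟨ sum-cong-≗ (λ y → trans (cong (A y x + A x y +_) (ℕ.*-identityʳ _)) (arc-total x y)) ⟩
    sum {n} (const 1)  ≡⟨ sum-const n 1 ⟩
    n * 1              ≡⟨ ℕ.*-identityʳ n ⟩
    n                  ∎
    where open ≡-Reasoning

  codeg-comm : ∀ x y → codeg x y ≡ codeg y x
  codeg-comm x y = sum-cong-≗ (λ z → ℕ.*-comm (A x z) (A y z))

  codeg-diag : ∀ x → codeg x x ≡ outdeg x
  codeg-diag x = sum-cong-≗ (λ z → idem (arc 𝕋 x z))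
    where
    idem : ∀ b → ⟦ b ⟧ * ⟦ b ⟧ ≡ ⟦ b ⟧
    idem true  = refl
    idem false = refl

  -- Exchange the sums: each out-neighbour `z` of `x` is counted once for every in-neighbour `y` of
  -- `z`, with `y = x` included.
  sum-codeg : ∀ {r} → (∀ z → indeg z ≡ r) → ∀ x → sum (codeg x) ≡ outdeg x * r
  sum-codeg {r} indeg≡r x = begin
    sum (λ y → sum (λ z → A x z * A y z))
      ≡⟨ ∑-comm (λ y z → A x z * A y z) ⟩
    sum (λ z → sum (λ y → A x z * A y z))
      ≡⟨ sum-cong-≗ (λ z → *-distribˡ-sum (A x z) (λ y → A y z)) ⟨
    sum (λ z → A x z * indeg z)
      ≡⟨ sum-cong-≗ (λ z → cong (A x z *_) (indeg≡r z)) ⟩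
    sum (λ z → A x z * r)
      ≡⟨ *-distribʳ-sum r (A x) ⟨
    outdeg x * r ∎
    where open ≡-Reasoning

  ∣commonOut∣ : ∀ x y → ∣ commonOut 𝕋 x y ∣ ≡ codeg x y
  ∣commonOut∣ x y = trans (∣tabulate∣ (λ z → arc 𝕋 x z ∧ arc 𝕋 y z))
    (sum-cong-≗ (λ z → ⟦∧⟧ (arc 𝕋 x z) (arc 𝕋 y z)))

-- Reversals at a single vertex and their cost.

-- The smallest reversal after which every b ≢ x satisfies x ⟶ b exactly
-- when t b holds.
module Redirect (𝕋 : Tournament n) (x : Fin n) (t : Fin n → Bool) where
  open Tournament 𝕋 using (orient)
  open Degrees 𝕋

  R : PairSet n
  R a b = arc 𝕋 a b ∧ ((does (a ≟ x) ∧ not (t b)) ∨ (does (b ≟ x) ∧ t a))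

  R⊆A : ArcsOf 𝕋 R
  R⊆A a b = ∧-conicalˡ (arc 𝕋 a b) _

  redirected : Tournament n
  redirected = reverse 𝕋 R R⊆A

  cost : ℕ
  cost = sum (λ b → A x b * ⟦ not (t b) ⟧) + sum (λ a → A a x * ⟦ t a ⟧)

  -- Union bound over the two ends at which `x` can occur. The factors `δ` let `sum-δ` collapse the
  -- double sum in `card-R` to the row and the column of `x`.
  ⟦R⟧-≤ : ∀ a b →
    ⟦ R a b ⟧ ≤ δ a x * (A a b * ⟦ not (t b) ⟧) + δ b x * (A a b * ⟦ t a ⟧)
  ⟦R⟧-≤ a b = begin
    ⟦ R a b ⟧                      ≡⟨ ⟦∧⟧ (arc 𝕋 a b) (p ∨ q) ⟩
    A a b * ⟦ p ∨ q ⟧              ≤⟨ ℕ.*-monoʳ-≤ (A a b) (⟦∨⟧-≤ p q) ⟩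
    A a b * (⟦ p ⟧ + ⟦ q ⟧)
      ≡⟨ cong (A a b *_) (cong₂ _+_ (⟦∧⟧ (does (a ≟ x)) _) (⟦∧⟧ (does (b ≟ x)) _)) ⟩
    A a b * (δ a x * ⟦ not (t b) ⟧ + δ b x * ⟦ t a ⟧)
      ≡⟨ rearrange (A a b) (δ a x) _ (δ b x) _ ⟩
    δ a x * (A a b * ⟦ not (t b) ⟧) + δ b x * (A a b * ⟦ t a ⟧) ∎
    where
    open ℕ.≤-Reasoning
    p q : Bool
    p = does (a ≟ x) ∧ not (t b)
    q = does (b ≟ x) ∧ t a
    rearrange : ∀ m d u e v → m * (d * u + e * v) ≡ d * (m * u) + e * (m * v)
    rearrange = solve-∀

  card-R : card R ≤ cost
  card-R = begin
    card R
      ≡⟨ sum-cong-≗ (λ a → ∣tabulate∣ (R a)) ⟩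
    sum (λ a → sum (λ b → ⟦ R a b ⟧))
      ≤⟨ sum-mono-≤ (λ a → sum-mono-≤ (⟦R⟧-≤ a)) ⟩
    sum (λ a → sum (λ b → out a b + in′ a b))
      ≡⟨ sum-cong-≗ (λ a → ∑-distrib-+ (out a) (in′ a)) ⟩
    sum (λ a → sum (out a) + sum (in′ a))
      ≡⟨ ∑-distrib-+ (λ a → sum (out a)) (λ a → sum (in′ a)) ⟩
    sum (λ a → sum (out a)) + sum (λ a → sum (in′ a))
      ≡⟨ cong₂ _+_
           (trans (∑-comm out) (sum-cong-≗ (λ b → sum-δ x (λ a → A a b * ⟦ not (t b) ⟧))))
           (sum-cong-≗ (λ a → sum-δ x (λ b → A a b * ⟦ t a ⟧))) ⟩
    cost ∎
    where
    open ℕ.≤-Reasoning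
    out in′ : Fin n → Fin n → ℕ
    out a b = δ a x * (A a b * ⟦ not (t b) ⟧)
    in′ a b = δ b x * (A a b * ⟦ t a ⟧)

  arc-at : ∀ b → b ≢ x → arc redirected x b ≡ t b
  arc-at b b≢x
    rewrite dec-true (x ≟ x) refl | dec-false (b ≟ x) b≢x | orient b x b≢x
    with arc 𝕋 x b | t b
  ... | true  | true  = refl
  ... | true  | false = refl
  ... | false | true  = refl
  ... | false | false = refl

  arc-away : ∀ a b → a ≢ x → b ≢ x → arc redirected a b ≡ arc 𝕋 a b
  arc-away a b a≢x b≢x
    rewrite dec-false (a ≟ x) a≢x | dec-false (b ≟ x) b≢x
    with arc 𝕋 a b | arc 𝕋 b a
  ... | true  | true  = refl
  ... | true  | false = refl
  ... | false | true  = refl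
  ... | false | false = refl

-- Degree and codegree bounds from minimality.

module Bounds (𝕋 : Tournament n) (s : ℕ) (3≤n : 3 ≤ n)
  (minimal : ∀ B (B⊆A : ArcsOf 𝕋 B) → ¬ Simple (reverse 𝕋 B B⊆A) → s ≤ card B)
  where
  open Degrees 𝕋

  -- A nontrivial module of the redirected tournament refutes its simplicity, so minimality applies
  -- to `R`. The vertices `a`, `b`, `c` certify nontriviality.
  s≤cost : ∀ x t (let open Redirect 𝕋 x t) {M a b c} → IsModule redirected M →
    a ∈ M → b ∈ M → a ≢ b → c ∉ M → s ≤ cost
  s≤cost x t mod a∈M b∈M a≢b c∉M = ℕ.≤-trans
    (minimal R R⊆A λ (_ , simple) → nontrivial a∈M b∈M a≢b c∉M (simple _ mod)) card-R
    where open Redirect 𝕋 x t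

  -- With constant `t`, `x` dominates all other vertices or none, so the complement of `x` is a
  -- module. Two calls of `∃-distinct` give it two elements; the repeated argument in the first asks
  -- only for a vertex other than `x`.
  s≤constCost : ∀ x β → s ≤ Redirect.cost 𝕋 x (const β)
  s≤constCost x β with ∃-distinct 3≤n x x
  ... | y , y≢x , _ with ∃-distinct 3≤n x y
  ... | z , z≢x , z≢y =
    s≤cost x (const β) {M = ∁ ⁅ x ⁆} (λ w w∉M → at-x β w (x∈⁅y⁆⇒x≡y x (x∉∁p⇒x∈p w∉M)))
      (in-M z≢x) (in-M y≢x) z≢y (x∈p⇒x∉∁p (x∈⁅x⁆ x))
    where
    in-M : ∀ {w} → w ≢ x → w ∈ ∁ ⁅ x ⁆
    in-M w≢x = x∉p⇒x∈∁p (w≢x ∘ x∈⁅y⁆⇒x≡y x)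

    ∈M⇒≢x : ∀ {w} → w ∈ ∁ ⁅ x ⁆ → w ≢ x
    ∈M⇒≢x w∈M refl = x∈∁p⇒x∉p w∈M (x∈⁅x⁆ x)

    at-x : ∀ γ w → w ≡ x →
      let 𝕌 = Redirect.redirected 𝕋 x (const γ) in
      (∀ m → m ∈ ∁ ⁅ x ⁆ → arc 𝕌 m w ≡ true) ⊎ (∀ m → m ∈ ∁ ⁅ x ⁆ → arc 𝕌 w m ≡ true)
    at-x true  w refl = inj₂ λ m m∈M → arc-at m (∈M⇒≢x m∈M)
      where open Redirect 𝕋 x (const true)
    at-x false w refl = inj₁ λ m m∈M → trans
      (Tournament.orient redirected m x (∈M⇒≢x m∈M))
      (cong not (arc-at m (∈M⇒≢x m∈M)))
      where open Redirect 𝕋 x (const false)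

  -- The constant `false` reverses exactly the out-arcs of `x`; in `s≤indeg` the constant `true`
  -- reverses exactly its in-arcs.
  s≤outdeg : ∀ x → s ≤ outdeg x
  s≤outdeg x = subst (s ≤_) eq (s≤constCost x false)
    where
    open ≡-Reasoning
    eq : Redirect.cost 𝕋 x (const false) ≡ outdeg x
    eq = begin
      sum (λ b → A x b * 1) + sum (λ a → A a x * 0)
        ≡⟨ cong₂ _+_ (*-distribʳ-sum 1 (A x)) (*-distribʳ-sum 0 (λ a → A a x)) ⟨
      outdeg x * 1 + indeg x * 0  ≡⟨ simp (outdeg x) (indeg x) ⟩
      outdeg x                    ∎
      where
      simp : ∀ o i → o * 1 + i * 0 ≡ o
      simp = solve-∀

  s≤indeg : ∀ x → s ≤ indeg x
  s≤indeg x = subst (s ≤_) eq (s≤constCost x true)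
    where
    open ≡-Reasoning
    eq : Redirect.cost 𝕋 x (const true) ≡ indeg x
    eq = begin
      sum (λ b → A x b * 0) + sum (λ a → A a x * 1)
        ≡⟨ cong₂ _+_ (*-distribʳ-sum 0 (A x)) (*-distribʳ-sum 1 (λ a → A a x)) ⟨
      outdeg x * 0 + indeg x * 1  ≡⟨ simp (outdeg x) (indeg x) ⟩
      indeg x                     ∎
      where
      simp : ∀ o i → o * 0 + i * 1 ≡ i
      simp = solve-∀

  -- The cost is nearly the symmetric difference of the two out-neighbourhoods, hence the sum of the
  -- outdegrees minus twice the codegree. The correction `A y x` appears because `x` can be an
  -- out-neighbour of `y` but has no arc to itself to redirect.
  twinCost : ∀ x y →
    Redirect.cost 𝕋 x (arc 𝕋 y) + 2 * codeg x y + A y x ≡ outdeg x + outdeg y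
  twinCost x y = begin
    lose + gain + 2 * codeg x y + A y x
      ≡⟨ regroup lose gain (codeg x y) (A y x) ⟩
    (lose + codeg x y) + (gain + codeg x y + A y x)
      ≡⟨ cong₂ _+_ lose-eq gain-eq ⟩
    outdeg x + outdeg y ∎
    where
    open ≡-Reasoning
    lose gain : ℕ
    lose = sum (λ b → A x b * ⟦ not (arc 𝕋 y b) ⟧)
    gain = sum (λ a → A a x * A y a)

    regroup : ∀ l g c a → l + g + 2 * c + a ≡ (l + c) + (g + c + a)
    regroup = solve-∀

    split : ∀ m b → m * ⟦ not b ⟧ + m * ⟦ b ⟧ ≡ m
    split m true  = trans (cong (_+ m * 1) (ℕ.*-zeroʳ m)) (ℕ.*-identityʳ m)
    split m false = trans (cong₂ _+_ (ℕ.*-identityʳ m) (ℕ.*-zeroʳ m)) (ℕ.+-identityʳ m)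

    lose-eq : lose + codeg x y ≡ outdeg x
    lose-eq = trans
      (sym (∑-distrib-+ (λ b → A x b * ⟦ not (arc 𝕋 y b) ⟧) (λ b → A x b * A y b)))
      (sum-cong-≗ (λ b → split (A x b) (arc 𝕋 y b)))

    -- The out-neighbours of `y` split into in-neighbours of `x`, out-neighbours of `x`, and
    -- possibly `x` itself.
    gain-eq : gain + codeg x y + A y x ≡ outdeg y
    gain-eq = begin
      gain + codeg x y + A y x
        ≡⟨ cong (gain + codeg x y +_) (sum-δ x (A y)) ⟨
      gain + codeg x y + sum (λ a → δ a x * A y a)
        ≡⟨ cong (_+ sum (λ a → δ a x * A y a))
             (∑-distrib-+ (λ a → A a x * A y a) (λ a → A x a * A y a)) ⟨
      sum (λ a → A a x * A y a + A x a * A y a) + sum (λ a → δ a x * A y a)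
        ≡⟨ ∑-distrib-+ (λ a → A a x * A y a + A x a * A y a) (λ a → δ a x * A y a) ⟨
      sum (λ a → A a x * A y a + A x a * A y a + δ a x * A y a)
        ≡⟨ sum-cong-≗ (λ a → trans (factor (A a x) (A x a) (δ a x) (A y a))
             (trans (cong (_* A y a) (arc-total x a)) (ℕ.*-identityˡ (A y a)))) ⟩
      outdeg y ∎
      where
      factor : ∀ p q d m → p * m + q * m + d * m ≡ (p + q + d) * m
      factor = solve-∀

  -- Outside `M`, the redirected `x` copies `y`, while the arcs of `y` that avoid `x` are untouched.
  -- The third vertex `w` keeps `M` proper.
  s≤twinCost : ∀ x y → x ≢ y → s ≤ Redirect.cost 𝕋 x (arc 𝕋 y)
  s≤twinCost x y x≢y with ∃-distinct 3≤n x y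
  ... | w , w≢x , w≢y =
    s≤cost x (arc 𝕋 y) {M = M} isModule x∈M y∈M x≢y
      (λ w∈M → [ w≢x , w≢y ]′ (∈M⇒ w∈M))
    where
    open Redirect 𝕋 x (arc 𝕋 y)
    M : Subset n
    M = ⁅ x ⁆ ∪ ⁅ y ⁆

    x∈M : x ∈ M
    x∈M = x∈p∪q⁺ (inj₁ (x∈⁅x⁆ x))

    y∈M : y ∈ M
    y∈M = x∈p∪q⁺ (inj₂ (x∈⁅x⁆ y))

    ∈M⇒ : ∀ {m} → m ∈ M → m ≡ x ⊎ m ≡ y
    ∈M⇒ m∈M with x∈p∪q⁻ ⁅ x ⁆ ⁅ y ⁆ m∈M
    ... | inj₁ m∈ = inj₁ (x∈⁅y⁆⇒x≡y x m∈)
    ... | inj₂ m∈ = inj₂ (x∈⁅y⁆⇒x≡y y m∈)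

    from-M : ∀ m z → m ∈ M → z ∉ M → arc redirected m z ≡ arc 𝕋 y z
    from-M m z m∈M z∉M with ∈M⇒ m∈M
    ... | inj₁ refl = arc-at z λ { refl → z∉M x∈M }
    ... | inj₂ refl = arc-away y z (x≢y ∘ sym) λ { refl → z∉M x∈M }

    uniform : ∀ β z → z ∉ M → arc 𝕋 y z ≡ β →
      (∀ m → m ∈ M → arc redirected m z ≡ true) ⊎ (∀ m → m ∈ M → arc redirected z m ≡ true)
    uniform true  z z∉M eq = inj₁ λ m m∈M → trans (from-M m z m∈M z∉M) eq
    uniform false z z∉M eq = inj₂ λ m m∈M → trans
      (Tournament.orient redirected z m λ { refl → z∉M m∈M })
      (cong not (trans (from-M m z m∈M z∉M) eq))

    isModule : IsModule redirected M
    isModule z z∉M = uniform (arc 𝕋 y z) z z∉M refl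

  -- The dominated vertex is the one redirected: then the arc between `x` and `y` already agrees
  -- with `arc 𝕋 y y ≡ false` and is not reversed. This saves one unit, the `+ 1`, without which
  -- `C≤k-arc` would only reach `k + 1`.
  codeg-bound : ∀ x y → arc 𝕋 y x ≡ true → s + 2 * codeg x y + 1 ≤ outdeg x + outdeg y
  codeg-bound x y y⟶x = begin
    s + 2 * codeg x y + 1
      ≤⟨ ℕ.+-monoˡ-≤ 1 (ℕ.+-monoˡ-≤ (2 * codeg x y) (s≤twinCost x y x≢y)) ⟩
    Redirect.cost 𝕋 x (arc 𝕋 y) + 2 * codeg x y + 1
      ≡⟨ cong (Redirect.cost 𝕋 x (arc 𝕋 y) + 2 * codeg x y +_) (cong ⟦_⟧ y⟶x) ⟨
    Redirect.cost 𝕋 x (arc 𝕋 y) + 2 * codeg x y + A y x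
      ≡⟨ twinCost x y ⟩
    outdeg x + outdeg y ∎
    where
    open ℕ.≤-Reasoning
    x≢y : x ≢ y
    x≢y refl with () ← trans (sym y⟶x) (Tournament.irrefl 𝕋 x)

-- The one-vertex extension and its regularity.

addVertex : Tournament n → (Fin n → Bool) → Tournament (suc n)
addVertex {n} 𝕋 in? = record { arc = arc′ ; irrefl = irrefl′ ; orient = orient′ }
  where
  open Tournament 𝕋 using (irrefl; orient)

  arc′ : PairSet (suc n)
  arc′ zero    zero    = false
  arc′ zero    (suc y) = not (in? y)
  arc′ (suc x) zero    = in? x
  arc′ (suc x) (suc y) = arc 𝕋 x y

  irrefl′ : ∀ x → arc′ x x ≡ false
  irrefl′ zero    = refl
  irrefl′ (suc x) = irrefl x

  orient′ : ∀ x y → x ≢ y → arc′ x y ≡ not (arc′ y x)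
  orient′ zero    zero    0≢0 = contradiction refl 0≢0
  orient′ zero    (suc y) _   = refl
  orient′ (suc x) zero    _   = sym (not-involutive (in? x))
  orient′ (suc x) (suc y) x≢y = orient x y (x≢y ∘ cong suc)

module Extension (k : ℕ) (1≤k : 1 ≤ k) (𝕋 : Tournament (4 * k + 2))
  (minimal : ∀ B (B⊆A : ArcsOf 𝕋 B) → ¬ Simple (reverse 𝕋 B B⊆A) → 2 * k ≤ card B)
  where

  private
    N r : ℕ
    N = 4 * k + 2
    r = 2 * k + 1

  open Degrees 𝕋 using ()
    renaming (outdeg to outdegᵀ; indeg to indegᵀ; codeg to codegᵀ;
              codeg-comm to codegᵀ-comm; degree-sum to degree-sumᵀ)
  open Bounds 𝕋 (2 * k) (ℕ.≤-trans (s≤s (s≤s (s≤s z≤n))) (ℕ.+-monoˡ-≤ 2 (ℕ.*-monoʳ-≤ 4 1≤k)))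
    minimal using (s≤outdeg; s≤indeg; codeg-bound)

  low : Fin N → Bool
  low x = does (outdegᵀ x ℕ.≟ 2 * k)

  𝔻 : Tournament (suc N)
  𝔻 = addVertex 𝕋 low

  open Degrees 𝔻

  -- In- and outdegree add up to `4 * k + 1`, and the indegree takes at least `2 * k` of it.
  outdegᵀ≤r : ∀ x → outdegᵀ x ≤ r
  outdegᵀ≤r x = ℕ.+-cancelˡ-≤ (2 * k + 1) (outdegᵀ x) r (begin
    2 * k + 1 + outdegᵀ x      ≤⟨ ℕ.+-monoˡ-≤ (outdegᵀ x) (ℕ.+-monoˡ-≤ 1 (s≤indeg x)) ⟩
    indegᵀ x + 1 + outdegᵀ x   ≡⟨ swap (indegᵀ x) (outdegᵀ x) ⟩
    indegᵀ x + outdegᵀ x + 1   ≡⟨ degree-sumᵀ x ⟩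
    4 * k + 2                  ≡⟨ double k ⟩
    2 * k + 1 + (2 * k + 1)    ∎)
    where
    open ℕ.≤-Reasoning
    swap : ∀ i o → i + 1 + o ≡ i + o + 1
    swap = solve-∀
    double : ∀ k → 4 * k + 2 ≡ 2 * k + 1 + (2 * k + 1)
    double = solve-∀

  outdeg-suc : ∀ x → outdeg (suc x) ≡ r
  outdeg-suc x with outdegᵀ x ℕ.≟ 2 * k
  ... | yes o≡2k = trans
    (cong₂ (λ β o → ⟦ β ⟧ + o) (dec-true (outdegᵀ x ℕ.≟ 2 * k) o≡2k) o≡2k)
    (ℕ.+-comm 1 (2 * k))
  ... | no  o≢2k = trans
    (cong (λ β → ⟦ β ⟧ + outdegᵀ x) (dec-false (outdegᵀ x ℕ.≟ 2 * k) o≢2k))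
    (ℕ.≤-antisym (outdegᵀ≤r x)
      (subst (_≤ outdegᵀ x) (ℕ.+-comm 1 (2 * k)) (ℕ.≤∧≢⇒< (s≤outdeg x) (o≢2k ∘ sym))))

  degrees⇒ : ∀ {i o} → i + o + 1 ≡ suc N → o ≡ r → i ≡ r
  degrees⇒ {i} {o} i+o+1 refl = ℕ.+-cancelʳ-≡ (r + 1) i r
    (trans (sym (ℕ.+-assoc i r 1)) (trans i+o+1 (double k)))
    where
    double : ∀ k → suc (4 * k + 2) ≡ 2 * k + 1 + (2 * k + 1 + 1)
    double = solve-∀

  indeg-suc : ∀ x → indeg (suc x) ≡ r
  indeg-suc x = degrees⇒ (degree-sum (suc x)) (outdeg-suc x)

  -- Outdegrees and indegrees have the same total, and all old vertices contribute `r` to each. This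
  -- settles the new vertex without counting the vertices marked by `low`.
  outdeg-zero≡indeg-zero : outdeg zero ≡ indeg zero
  outdeg-zero≡indeg-zero = ℕ.+-cancelʳ-≡ (N * r) (outdeg zero) (indeg zero) (begin
    outdeg zero + N * r                           ≡⟨ cong (outdeg zero +_) (total outdeg-suc) ⟨
    outdeg zero + sum (λ x → outdeg (suc x))      ≡⟨ ∑-comm A ⟩
    indeg zero + sum (λ x → indeg (suc x))        ≡⟨ cong (indeg zero +_) (total indeg-suc) ⟩
    indeg zero + N * r                            ∎)
    where
    open ≡-Reasoning
    total : ∀ {f : Fin N → ℕ} → (∀ x → f x ≡ r) → sum f ≡ N * r
    total f≡r = trans (sum-cong-≗ f≡r) (sum-const N r)

  outdeg-zero : outdeg zero ≡ r
  outdeg-zero = ℕ.*-cancelˡ-≡ (outdeg zero) r 2 (ℕ.+-cancelʳ-≡ 1 (2 * outdeg zero) (2 * r) (begin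
    2 * outdeg zero + 1            ≡⟨ cong (_+ 1) (double (outdeg zero)) ⟩
    outdeg zero + outdeg zero + 1  ≡⟨ cong (λ i → i + outdeg zero + 1) outdeg-zero≡indeg-zero ⟩
    indeg zero + outdeg zero + 1   ≡⟨ degree-sum zero ⟩
    suc (4 * k + 2)                ≡⟨ arith k ⟩
    2 * r + 1                      ∎))
    where
    open ≡-Reasoning
    double : ∀ o → 2 * o ≡ o + o
    double = solve-∀
    arith : ∀ k → suc (4 * k + 2) ≡ 2 * (2 * k + 1) + 1
    arith = solve-∀

  outdeg≡r : ∀ x → outdeg x ≡ r
  outdeg≡r zero    = outdeg-zero
  outdeg≡r (suc x) = outdeg-suc x

  indeg≡r : ∀ x → indeg x ≡ r
  indeg≡r x = degrees⇒ (degree-sum x) (outdeg≡r x)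

  -- Double counting of common out-neighbours.

  codeg-row : ∀ x → sum (codeg x) ≡ r * r
  codeg-row x = trans (sum-codeg indeg≡r x) (cong (_* r) (outdeg≡r x))

  C : Fin N → Fin N → ℕ
  C x y = codeg (suc x) (suc y)

  -- Passing to `𝔻` raises the outdegrees to `r` and twice the codegree by at most as much, so
  -- `codeg-bound` survives as `2 * k + 2 * C x y + 1 ≤ 2 * r`. Hence `2 * C x y < 2 * (k + 1)`.
  C≤k-arc : ∀ x y → arc 𝕋 y x ≡ true → C x y ≤ k
  C≤k-arc x y y⟶x = ℕ.m<1+n⇒m≤n (ℕ.*-cancelˡ-< 2 (C x y) (suc k)
    (ℕ.+-cancelˡ-≤ (2 * k) (suc (2 * C x y)) (2 * suc k) (begin
      -- `C x y` unfolds to `p * q + c`: the new vertex is a common out-neighbour exactly when both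
      -- vertices are `low`.
      2 * k + suc (2 * (p * q + c))              ≡⟨ regroup (2 * k) (p * q) c ⟩
      (2 * k + 2 * c + 1) + 2 * (p * q)
        ≤⟨ ℕ.+-mono-≤ (codeg-bound x y y⟶x) (2pq≤p+q (low x) (low y)) ⟩
      (outdegᵀ x + outdegᵀ y) + (p + q)          ≡⟨ pair (outdegᵀ x) (outdegᵀ y) p q ⟩
      (p + outdegᵀ x) + (q + outdegᵀ y)          ≡⟨ cong₂ _+_ (outdeg-suc x) (outdeg-suc y) ⟩
      r + r                                      ≡⟨ double k ⟩
      2 * k + 2 * suc k                          ∎)))
    where
    open ℕ.≤-Reasoning
    p q c : ℕ
    p = ⟦ low x ⟧
    q = ⟦ low y ⟧
    c = codegᵀ x y
    regroup : ∀ s m c → s + suc (2 * (m + c)) ≡ (s + 2 * c + 1) + 2 * m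
    regroup = solve-∀
    pair : ∀ o o′ p q → (o + o′) + (p + q) ≡ (p + o) + (q + o′)
    pair = solve-∀
    double : ∀ k → (2 * k + 1) + (2 * k + 1) ≡ 2 * k + 2 * suc k
    double = solve-∀
    2pq≤p+q : ∀ a b → 2 * (⟦ a ⟧ * ⟦ b ⟧) ≤ ⟦ a ⟧ + ⟦ b ⟧
    2pq≤p+q true  true  = ℕ.≤-refl
    2pq≤p+q true  false = z≤n
    2pq≤p+q false b     = z≤n

  C≤k : ∀ x y → x ≢ y → C x y ≤ k
  C≤k x y x≢y = go (arc 𝕋 y x) refl
    where
    go : ∀ β → arc 𝕋 y x ≡ β → C x y ≤ k
    go true  y⟶x = C≤k-arc x y y⟶x
    go false y↛x = subst (_≤ k) (codeg-comm (suc y) (suc x))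
      (C≤k-arc y x (trans (Tournament.orient 𝕋 x y x≢y) (cong not y↛x)))

  -- On the diagonal this is 2k+1, the outdegree, so that it dominates all of C.
  bound : Fin N → Fin N → ℕ
  bound x y = k + δ y x * (k + 1)

  C≤bound : ∀ x y → C x y ≤ bound x y
  C≤bound x y with y ≟ x
  ... | yes refl = ℕ.≤-reflexive (trans (codeg-diag (suc x)) (trans (outdeg-suc x) (arith k)))
    where
    arith : ∀ k → 2 * k + 1 ≡ k + 1 * (k + 1)
    arith = solve-∀
  ... | no y≢x   = ℕ.≤-trans (C≤k x y (y≢x ∘ sym)) (ℕ.m≤m+n k _)

  sum-bound : ∀ x → sum (bound x) ≡ N * k + (k + 1)
  sum-bound x = trans (∑-distrib-+ (const k) (λ y → δ y x * (k + 1)))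
    (cong₂ _+_ (sum-const N k) (sum-δ x (const (k + 1))))

  -- By symmetry this is the row of the new vertex without its diagonal entry `r`.
  sum-codeg-zero : sum (λ x → codeg (suc x) zero) ≡ 2 * k * r
  sum-codeg-zero = ℕ.+-cancelˡ-≡ r _ _ (begin
    r + sum (λ x → codeg (suc x) zero)
      ≡⟨ cong₂ _+_ (trans (codeg-diag zero) outdeg-zero)
           (sum-cong-≗ (λ x → codeg-comm zero (suc x))) ⟨
    sum (codeg zero)  ≡⟨ codeg-row zero ⟩
    r * r             ≡⟨ arith k ⟩
    r + 2 * k * r     ∎)
    where
    open ≡-Reasoning
    arith : ∀ k → (2 * k + 1) * (2 * k + 1) ≡ (2 * k + 1) + 2 * k * (2 * k + 1)
    arith = solve-∀

  -- The `N` old rows of `𝔻` total `N * (r * r)`. Removing their entries at the new vertex leaves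
  -- the sum of `C`, which `arith` matches with the sum of `bound`.
  ∑bound≡∑C : sum (λ x → sum (bound x)) ≡ sum (λ x → sum (C x))
  ∑bound≡∑C = ℕ.+-cancelˡ-≡ (2 * k * r) _ _ (begin
    2 * k * r + sum (λ x → sum (bound x))
      ≡⟨ cong (2 * k * r +_) (trans (sum-cong-≗ sum-bound) (sum-const N _)) ⟩
    2 * k * r + N * (N * k + (k + 1))
      ≡⟨ arith k ⟩
    N * (r * r)
      ≡⟨ trans (sum-cong-≗ (λ x → codeg-row (suc x))) (sum-const N _) ⟨
    sum (λ x → codeg (suc x) zero + sum (C x))
      ≡⟨ ∑-distrib-+ (λ x → codeg (suc x) zero) (λ x → sum (C x)) ⟩
    sum (λ x → codeg (suc x) zero) + sum (λ x → sum (C x))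
      ≡⟨ cong (_+ sum (λ x → sum (C x))) sum-codeg-zero ⟩
    2 * k * r + sum (λ x → sum (C x)) ∎)
    where
    open ≡-Reasoning
    arith : ∀ k → 2 * k * (2 * k + 1) + (4 * k + 2) * ((4 * k + 2) * k + (k + 1))
                ≡ (4 * k + 2) * ((2 * k + 1) * (2 * k + 1))
    arith = solve-∀

  -- Tightness is used twice: here on the row sums, then in `C≡bound` on the entries of each row.
  sum-C : ∀ x → sum (C x) ≡ sum (bound x)
  sum-C = sum-tight (λ x → sum-mono-≤ (C≤bound x)) (ℕ.≤-reflexive ∑bound≡∑C)

  C≡bound : ∀ x y → C x y ≡ bound x y
  C≡bound x = sum-tight (C≤bound x) (ℕ.≤-reflexive (sym (sum-C x)))

  -- The entry at the new vertex is what remains of the full row sum `r * r` once the now known sum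
  -- over the old vertices is subtracted.
  codeg-suc-zero : ∀ x → codeg (suc x) zero ≡ k
  codeg-suc-zero x = ℕ.+-cancelʳ-≡ (N * k + (k + 1)) _ _ (begin
    codeg (suc x) zero + (N * k + (k + 1))
      ≡⟨ cong (codeg (suc x) zero +_) (trans (sum-C x) (sum-bound x)) ⟨
    sum (codeg (suc x))    ≡⟨ codeg-row (suc x) ⟩
    r * r                  ≡⟨ arith k ⟩
    k + (N * k + (k + 1))  ∎)
    where
    open ≡-Reasoning
    arith : ∀ k → (2 * k + 1) * (2 * k + 1) ≡ k + ((4 * k + 2) * k + (k + 1))
    arith = solve-∀

  codeg≡k : ∀ x y → x ≢ y → codeg x y ≡ k
  codeg≡k zero    zero    0≢0 = contradiction refl 0≢0
  codeg≡k zero    (suc y) _   = trans (codeg-comm zero (suc y)) (codeg-suc-zero y)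
  codeg≡k (suc x) zero    _   = codeg-suc-zero x
  codeg≡k (suc x) (suc y) x≢y = begin
    C x y                  ≡⟨ C≡bound x y ⟩
    k + δ y x * (k + 1)
      ≡⟨ cong (λ β → k + ⟦ β ⟧ * (k + 1)) (dec-false (y ≟ x) (x≢y ∘ cong suc ∘ sym)) ⟩
    k + 0                  ≡⟨ ℕ.+-identityʳ k ⟩
    k                      ∎
    where open ≡-Reasoning

  doublyRegular : DoublyRegular 𝔻
  doublyRegular = k , 1≤k , λ x y x≢y → trans (∣commonOut∣ x y) (codeg≡k x y x≢y)

theorem1p3 : (k : ℕ) → 1 ≤ k → (𝕋 : Tournament (4 * k + 2)) →
    SimplicityIndex 𝕋 (2 * k) → ObtainedByRemovingVertexFromDoublyRegular 𝕋
theorem1p3 k 1≤k 𝕋 (_ , minimal) =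
  -- The new vertex is `zero` and `punchIn zero` computes to `suc`, so `remove zero 𝔻` has the arcs
  -- of `𝕋` definitionally.
  𝔻 , doublyRegular , zero , idₚ , λ _ _ → refl
  where open Extension k 1≤k 𝕋 minimal
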